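{- Let $G$ be a quadrangulation on an orientable surface with a proper vertex-$4$-coloring $g: V(G)\to\{1,2,3,4\}$. Then the number of $(c_1,c_2,c_3,c_4)$-faces in $G$ equals the number of $(c_4,c_3,c_2,c_1)$-faces in $G$, where $\{c_1,c_2,c_3,c_4\}=\{1,2,3,4\}$.
   Context: All graphs are loopless and finite. A cycle is a connected $2$-regular graph. An orientable surface here means a sphere with $k\ge 0$ attached handles. A quadrangulation on such a surface is a $2$-edge-connected graph embedded on the surface such that every face boundary is a cycle of length four. A vertex-coloring is proper if any two adjacent vertices receive different colors. Since the surface is orientable, the clockwise orientation can be fixed, and is fixed, in all faces of $G$ simultaneously. A face of $G$ is a rainbow-face if all four colors appear on its boundary. For $\{c_1,c_2,c_3,c_4\}=\{1,2,3,4\}$, a rainbow-face $F$ is a $(c_1,c_2,c_3,c_4)$-face if the four distinct colors $c_1,c_2,c_3,c_4$ appear on the boundary of $F$ in this clockwise order. This is understood up to cyclic rotation: a $(c_1,c_2,c_3,c_4)$-face is also a $(c_2,c_3,c_4,c_1)$-face, a $(c_3,c_4,c_1,c_2)$-face and a $(c_4,c_1,c_2,c_3)$-face. -}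

module Defs where

open import Data.Bool.Base using (Bool; true; false; not)
open import Data.Fin.Base using (Fin; toℕ)
open import Data.Fin.Properties using (_≟_; any?)
open import Data.List.Base using (length; filter; allFin)
open import Data.Nat.Base using (ℕ; _+_; _*_; _<_)
open import Data.Product.Base using (_×_; _,_; ∃-syntax; Σ-syntax)
open import Data.Sum.Base using (inj₁; inj₂)
open import Data.Unit.Base using (⊤)
open import Function.Bundles using (_↔_; _⇔_; Inverse)
open import Function.Definitions using (Injective; StrictlySurjective)
import Function.Endo.Propositional as Endo
open import Relation.Binary.Construct.Closure.ReflexiveTransitive using (Star)
open import Relation.Binary.PropositionalEquality.Core using (_≡_; _≢_)
open import Relation.Nullary.Decidable using (Dec; map′; _×-dec_; _⊎-dec_)

-- Parallel edges are allowed.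
record Graph : Set where
  field
    #vertices : ℕ
    #edges    : ℕ

  Vertex : Set
  Vertex = Fin #vertices

  Edge : Set
  Edge = Fin #edges

  field
    end      : Edge → Bool → Vertex
    loopless : ∀ e → end e false ≢ end e true

  -- A dart is an edge with a direction: (e , b) runs from end e b to
  -- end e (not b).
  Dart : Set
  Dart = Edge × Bool

  tail head : Dart → Vertex
  tail (e , b) = end e b
  head (e , b) = end e (not b)

  reverse : Dart → Dart
  reverse (e , b) = e , not b

  ConnectedUsing : (Edge → Set) → Set
  ConnectedUsing Keep = ∀ u v → Star Step u v
    where
    Step : Vertex → Vertex → Set
    Step x y = Σ[ e ∈ Edge ] ∃[ b ] Keep e × end e b ≡ x × end e (not b) ≡ y

  Connected : Set
  Connected = ConnectedUsing (λ _ → ⊤)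

  TwoEdgeConnected : Set
  TwoEdgeConnected =
    1 < #vertices × Connected × (∀ e → ConnectedUsing (_≢ e))

-- Embeddings of a connected graph in the closed orientable surface with k
-- handles, all faces being open discs, presented by rotation systems: at each
-- vertex the darts leaving it are arranged in anticlockwise cyclic order.
record Embedding (G : Graph) (k : ℕ) : Set where
  open Graph G
  field
    rotation        : Dart ↔ Dart
    rotation-tail   : ∀ d → tail (Inverse.to rotation d) ≡ tail d
    rotation-cyclic : ∀ d d′ → tail d ≡ tail d′ →
                      ∃[ n ] (Dart Endo.^ Inverse.to rotation) n d ≡ d′

  -- Arriving at the head of d and turning into the dart anticlockwise next to
  -- the reversal of d keeps the face to the right of d on the right, so that
  -- this face's boundary is traversed clockwise.
  next : Dart → Dart
  next d = Inverse.to rotation (reverse d)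

  next^ : ℕ → Dart → Dart
  next^ = Dart Endo.^ next

  -- The faces are the orbits of next; face sends each dart to the face on its
  -- right.  The last field is Euler's formula V - E + F = 2 - 2k, which
  -- identifies the surface.
  field
    #faces          : ℕ
    face            : Dart → Fin #faces
    face-surjective : StrictlySurjective _≡_ face
    face-orbit      : ∀ d d′ → (face d ≡ face d′) ⇔ (∃[ n ] next^ n d ≡ d′)
    euler           : #vertices + #faces + 2 * k ≡ #edges + 2

  Face : Set
  Face = Fin #faces

  -- The facial walk through d closes up after n steps and its n vertices are
  -- pairwise distinct.
  BoundaryCycle : ℕ → Dart → Set
  BoundaryCycle n d =
    next^ n d ≡ d ×
    Injective _≡_ _≡_ (λ (i : Fin n) → tail (next^ (toℕ i) d))

record Quadrangulation (k : ℕ) : Set where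
  field
    graph              : Graph
    two-edge-connected : Graph.TwoEdgeConnected graph
    embedding          : Embedding graph k

  open Graph graph public
  open Embedding embedding public

  field
    quadrangular : ∀ d → BoundaryCycle 4 d

Color : Set
Color = Fin 4

module _ {k : ℕ} (Q : Quadrangulation k) where
  open Quadrangulation Q

  ProperColoring : (Vertex → Color) → Set
  ProperColoring g = ∀ d → g (tail d) ≢ g (head d)

  -- The starting dart d is arbitrary, so the order is up to cyclic rotation.
  ClockwiseColors : (Vertex → Color) → (c₁ c₂ c₃ c₄ : Color) → Face → Set
  ClockwiseColors g c₁ c₂ c₃ c₄ f = Σ[ d ∈ Dart ]
    face d ≡ f ×
    g (tail d)           ≡ c₁ ×
    g (tail (next^ 1 d)) ≡ c₂ ×
    g (tail (next^ 2 d)) ≡ c₃ ×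
    g (tail (next^ 3 d)) ≡ c₄

  anyDart? : {P : Dart → Set} → (∀ d → Dec (P d)) → Dec (Σ[ d ∈ Dart ] P d)
  anyDart? P? =
    map′ (λ { (e , inj₁ p) → (e , false) , p ; (e , inj₂ p) → (e , true) , p })
         (λ { ((e , false) , p) → e , inj₁ p ; ((e , true) , p) → e , inj₂ p })
         (any? λ e → P? (e , false) ⊎-dec P? (e , true))

  clockwiseColors? : ∀ g c₁ c₂ c₃ c₄ f → Dec (ClockwiseColors g c₁ c₂ c₃ c₄ f)
  clockwiseColors? g c₁ c₂ c₃ c₄ f = anyDart? λ d →
    (face d ≟ f) ×-dec
    (g (tail d)           ≟ c₁) ×-dec
    (g (tail (next^ 1 d)) ≟ c₂) ×-dec
    (g (tail (next^ 2 d)) ≟ c₃) ×-dec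
    (g (tail (next^ 3 d)) ≟ c₄)

  #facesColored : (Vertex → Color) → (c₁ c₂ c₃ c₄ : Color) → ℕ
  #facesColored g c₁ c₂ c₃ c₄ =
    length (filter (clockwiseColors? g c₁ c₂ c₃ c₄) (allFin #faces))

{-# OPTIONS --safe #-}

-- Let φ(c₁,c₂) = φ(c₃,c₄) = 1, φ(c₂,c₁) = φ(c₄,c₃) = -1 and φ = 0 on all other
-- pairs of colors.  As φ is antisymmetric, its sum over all darts vanishes.
-- Around a face with clockwise colors c₁c₂c₃c₄ or c₄c₃c₂c₁ it sums to 2 or -2,
-- and around every other face of a properly colored quadrangulation to 0.
-- The faces of a rainbow type are counted by their unique darts with tail of
-- the first color; summing over all darts d the sums of φ around the face of d
-- counts every dart four times.
module Submission where

open import Defs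
import Algebra.Properties.Semiring.Sum as Sum
open import Data.Bool.Base using (if_then_else_)
open import Data.Bool.Properties using (not-involutive)
open import Data.Fin.Base using (Fin; zero; suc; toℕ; punchIn; punchOut)
open import Data.Fin.Patterns using (0F; 1F; 2F; 3F)
open import Data.Fin.Properties
  using (_≟_; all?; any?; *↔×; 2↔Bool; injective⇒≤; punchOut-injective; punchInᵢ≢i)
open import Data.List.Base using (_∷_; []; length; filter; tabulate; allFin; lookup)
open import Data.List.Membership.Propositional using (_∈_)
open import Data.List.Properties using (filter-≐)
open import Data.List.Relation.Unary.Any using (index)
open import Data.List.Relation.Unary.Any.Properties using (lookup-index)
open import Data.Nat.Base using (ℕ; zero; suc; _+_; _*_)
import Data.Nat.Properties as ℕ
open import Data.Product.Base using (_×_; _,_; ∃; proj₁)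
open import Data.Product.Function.NonDependent.Propositional using (_×-↔_)
open import Data.Vec.Functional using (removeAt)
open import Function.Base using (_∘_; id)
open import Function.Bundles using (_↔_; _⇔_; Equivalence; Inverse; mk⇔; mk↔ₛ′)
open import Function.Definitions using (Injective; StrictlySurjective)
open import Function.Properties.Inverse using (↔-refl; ↔-sym; ↔-trans)
open import Relation.Binary.PropositionalEquality.Core
  using (_≡_; _≢_; refl; sym; trans; cong; cong₂; subst)
open import Relation.Binary.PropositionalEquality.Properties using (module ≡-Reasoning)
open import Relation.Nullary.Decidable
  using (Dec; does; yes; no; _×-dec_; _→-dec_; ¬?; from-yes; dec-true; dec-false)
open import Relation.Nullary.Negation.Core using (¬_; contradiction)
open import Relation.Unary using (Decidable)

open Sum ℕ.+-*-semiring
  using (sum; sum-cong-≗; sum-remove; sum-replicate-zero; sum-permute; *-distribˡ-sum;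
         ∑-distrib-+; ∑-comm)
open ≡-Reasoning

-- Finite counting and sums of indicators.

injective⇒strictlySurjective : ∀ {n} {f : Fin n → Fin n} →
                               Injective _≡_ _≡_ f → StrictlySurjective _≡_ f
injective⇒strictlySurjective {suc n} {f} inj i with any? (λ j → f j ≟ i)
... | yes ∃j = ∃j
-- A missed value `i` can be punched out of the codomain, leaving an injection of `Fin (suc n)` into
-- `Fin n`.
... | no ∄j = contradiction (injective⇒≤ punchOut∘f-injective) ℕ.1+n≰n
  where
  i≢f : ∀ j → i ≢ f j
  i≢f j i≡fj = ∄j (j , sym i≡fj)

  punchOut∘f-injective : Injective _≡_ _≡_ (λ j → punchOut (i≢f j))
  punchOut∘f-injective = inj ∘ punchOut-injective (i≢f _) (i≢f _)

indicator : {P : Set} → Dec P → ℕ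
indicator P? = if does P? then 1 else 0

indicator-true : {P : Set} (P? : Dec P) → P → indicator P? ≡ 1
indicator-true P? p = cong (if_then 1 else 0) (dec-true P? p)

indicator-false : {P : Set} (P? : Dec P) → ¬ P → indicator P? ≡ 0
indicator-false P? ¬p = cong (if_then 1 else 0) (dec-false P? ¬p)

length-filter-tabulate : ∀ {A : Set} {n} {Q : A → Set} (Q? : Decidable Q) (f : Fin n → A) →
                         length (filter Q? (tabulate f)) ≡ sum (indicator ∘ Q? ∘ f)
length-filter-tabulate {n = zero}  Q? f = refl
length-filter-tabulate {n = suc n} Q? f with Q? (f zero)
... | yes _ = cong suc (length-filter-tabulate Q? (f ∘ suc))
... | no  _ = length-filter-tabulate Q? (f ∘ suc)

sum-zero : ∀ {n} {t : Fin n → ℕ} → (∀ i → t i ≡ 0) → sum t ≡ 0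
sum-zero {n} t≗0 = trans (sum-cong-≗ t≗0) (sum-replicate-zero n)

-- At most one summand is nonzero, and there is one exactly when `P` holds. This serves both sides
-- of the double count of incident darts and faces.
sum-indicator-unique : ∀ {n} {P : Set} {Q : Fin n → Set} (P? : Dec P) (Q? : Decidable Q) →
                       (∀ i → Q i → P) → (P → ∃ Q) → (∀ {i j} → Q i → Q j → i ≡ j) →
                       sum (indicator ∘ Q?) ≡ indicator P?
sum-indicator-unique P? Q? Q⇒P P⇒Q unique with P?
... | no ¬p = sum-zero λ i → indicator-false (Q? i) (¬p ∘ Q⇒P i)
... | yes p with P⇒Q p
sum-indicator-unique {suc n} P? Q? _ _ unique | yes p | i , q = begin
  sum (indicator ∘ Q?)
    ≡⟨ sum-remove {i = i} (indicator ∘ Q?) ⟩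
  indicator (Q? i) + sum (removeAt (indicator ∘ Q?) i)
    ≡⟨ cong₂ _+_ (indicator-true (Q? i) q)
         (sum-zero λ j → indicator-false (Q? (punchIn i j)) λ q′ → punchInᵢ≢i i j (unique q′ q)) ⟩
  1 ∎

module _ {A : Set} {n} (enum : Fin n ↔ A) where
  open Inverse

  -- Conjugating `π` by `enum` gives a permutation of the indices, so `sum-permute` carries over to
  -- any enumerated set.
  sum-reindex : (π : A ↔ A) (f : A → ℕ) → sum (f ∘ to π ∘ to enum) ≡ sum (f ∘ to enum)
  sum-reindex π f = begin
    sum (f ∘ to π ∘ to enum)
      ≡⟨ sum-cong-≗ (λ i → cong f (strictlyInverseˡ enum (to π (to enum i)))) ⟨
    sum (f ∘ to enum ∘ from enum ∘ to π ∘ to enum)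
      ≡⟨ sum-permute (f ∘ to enum) (↔-trans enum (↔-trans π (↔-sym enum))) ⟨
    sum (f ∘ to enum) ∎

-- Color patterns and weights around a four-cycle.

Matches : (c₁ c₂ c₃ c₄ x₁ x₂ x₃ x₄ : Color) → Set
Matches c₁ c₂ c₃ c₄ x₁ x₂ x₃ x₄ = x₁ ≡ c₁ × x₂ ≡ c₂ × x₃ ≡ c₃ × x₄ ≡ c₄

matches? : ∀ c₁ c₂ c₃ c₄ x₁ x₂ x₃ x₄ → Dec (Matches c₁ c₂ c₃ c₄ x₁ x₂ x₃ x₄)
matches? c₁ c₂ c₃ c₄ x₁ x₂ x₃ x₄ =
  (x₁ ≟ c₁) ×-dec (x₂ ≟ c₂) ×-dec (x₃ ≟ c₃) ×-dec (x₄ ≟ c₄)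

match : (c₁ c₂ c₃ c₄ x₁ x₂ x₃ x₄ : Color) → ℕ
match c₁ c₂ c₃ c₄ x₁ x₂ x₃ x₄ = indicator (matches? c₁ c₂ c₃ c₄ x₁ x₂ x₃ x₄)

-- The positive part of φ for the colors 0, 1, 2, 3; its negative part has the
-- arguments exchanged.
φ⁺ : Color → Color → ℕ
φ⁺ 0F 1F = 1
φ⁺ 2F 3F = 1
φ⁺ _  _  = 0

-- Each pattern joins the half of `φ` that vanishes around its own faces. Such a face matches from
-- exactly one of its four darts, and 2 is the total of the other half there.
weight⁺ weight⁻ : (x₁ x₂ x₃ x₄ : Color) → ℕ
weight⁺ x₁ x₂ x₃ x₄ = φ⁺ x₁ x₂ + 2 * match 3F 2F 1F 0F x₁ x₂ x₃ x₄
weight⁻ x₁ x₂ x₃ x₄ = φ⁺ x₂ x₁ + 2 * match 0F 1F 2F 3F x₁ x₂ x₃ x₄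

-- Ends in 0 so as to be the unfolding of sum over Fin 4.
rotationSum : (Color → Color → Color → Color → ℕ) → (x₁ x₂ x₃ x₄ : Color) → ℕ
rotationSum w x₁ x₂ x₃ x₄ =
  w x₁ x₂ x₃ x₄ + (w x₂ x₃ x₄ x₁ + (w x₃ x₄ x₁ x₂ + (w x₄ x₁ x₂ x₃ + 0)))

-- The identity "φ summed around a face is 2 [0123] - 2 [3210]", with both sides
-- moved so that no subtraction occurs.
rotationSum-weight : ∀ x₁ x₂ x₃ x₄ → x₁ ≢ x₂ → x₂ ≢ x₃ → x₃ ≢ x₄ → x₄ ≢ x₁ →
                     rotationSum weight⁺ x₁ x₂ x₃ x₄ ≡ rotationSum weight⁻ x₁ x₂ x₃ x₄
rotationSum-weight = from-yes
  (all? λ x₁ → all? λ x₂ → all? λ x₃ → all? λ x₄ →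
   ¬? (x₁ ≟ x₂) →-dec ¬? (x₂ ≟ x₃) →-dec ¬? (x₃ ≟ x₄) →-dec ¬? (x₄ ≟ x₁) →-dec
   (rotationSum weight⁺ x₁ x₂ x₃ x₄ ℕ.≟ rotationSum weight⁻ x₁ x₂ x₃ x₄))

-- Sums over darts.

module _ {k : ℕ} (Q : Quadrangulation k) where
  open Quadrangulation Q
  open Inverse using (to; from; strictlyInverseˡ; strictlyInverseʳ)

  darts : Fin (#edges * 2) ↔ Dart
  darts = ↔-trans *↔× (↔-refl ×-↔ 2↔Bool)

  ∑ᵈ : (Dart → ℕ) → ℕ
  ∑ᵈ f = sum (f ∘ to darts)

  reverse-involutive : ∀ d → reverse (reverse d) ≡ d
  reverse-involutive (e , b) = cong (e ,_) (not-involutive b)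

  reverse↔ : Dart ↔ Dart
  reverse↔ = mk↔ₛ′ reverse reverse reverse-involutive reverse-involutive

  next↔ : Dart ↔ Dart
  next↔ = ↔-trans reverse↔ rotation

  next^↔ : ℕ → Dart ↔ Dart
  next^↔ zero    = ↔-refl
  next^↔ (suc n) = ↔-trans (next^↔ n) next↔

  to-next^↔ : ∀ n d → to (next^↔ n) d ≡ next^ n d
  to-next^↔ zero    d = refl
  to-next^↔ (suc n) d = cong next (to-next^↔ n d)

  ∑ᵈ-next^ : ∀ n f → ∑ᵈ (f ∘ next^ n) ≡ ∑ᵈ f
  ∑ᵈ-next^ n f = trans
    (sum-cong-≗ λ i → cong f (sym (to-next^↔ n (to darts i))))
    (sum-reindex darts (next^↔ n) f)

  next⁴ : ∀ d → next^ 4 d ≡ d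
  next⁴ d = proj₁ (quadrangular d)

  tail-next : ∀ d → tail (next d) ≡ head d
  tail-next d = rotation-tail (reverse d)

  head-reverse : ∀ d → head (reverse d) ≡ tail d
  head-reverse d = cong tail (reverse-involutive d)

  -- Every power of `next` permutes the darts, so after exchanging the two sums each of the four
  -- inner ones is `∑ᵈ f`.
  ∑ᵈ-boundary : ∀ f → ∑ᵈ (λ d → sum {4} λ i → f (next^ (toℕ i) d)) ≡ 4 * ∑ᵈ f
  ∑ᵈ-boundary f = trans
    (∑-comm (λ j i → f (next^ (toℕ {4} i) (to darts j))))
    (sum-cong-≗ {4} λ i → ∑ᵈ-next^ (toℕ i) f)

  -- Counting colored faces by darts.

  module _ (h : Vertex → Color) where

    color : ℕ → Dart → Color
    color n d = h (tail (next^ n d))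

    along : (Color → Color → Color → Color → ℕ) → Dart → ℕ
    along w d = w (color 0 d) (color 1 d) (color 2 d) (color 3 d)

    -- The shifted readings reach up to color 6; `next⁴` wraps the indices 4, 5, 6 to 0, 1, 2, which
    -- gives the four rotations of one quadruple.
    along-boundary : ∀ w d → sum {4} (λ i → along w (next^ (toℕ i) d)) ≡ along (rotationSum w) d
    along-boundary w d rewrite next⁴ d = refl

    module _ {c₁ c₂ c₃ c₄ : Color} (c₁≢c₂ : c₁ ≢ c₂) (c₁≢c₃ : c₁ ≢ c₃) (c₁≢c₄ : c₁ ≢ c₄) where

      MatchesAt : Dart → Set
      MatchesAt d = Matches c₁ c₂ c₃ c₄ (color 0 d) (color 1 d) (color 2 d) (color 3 d)

      matchesAt? : Decidable MatchesAt
      matchesAt? d = matches? c₁ c₂ c₃ c₄ (color 0 d) (color 1 d) (color 2 d) (color 3 d)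

      -- As `c₁` differs from the other three colors, it recurs along the boundary only after a
      -- multiple of four steps, and those lead back to `d`.
      orbit-matches-unique : ∀ n d → MatchesAt d → color n d ≡ c₁ → next^ n d ≡ d
      orbit-matches-unique 0 d _ _ = refl
      orbit-matches-unique 1 d (_ , m , _ , _) c = contradiction (trans (sym c) m) c₁≢c₂
      orbit-matches-unique 2 d (_ , _ , m , _) c = contradiction (trans (sym c) m) c₁≢c₃
      orbit-matches-unique 3 d (_ , _ , _ , m) c = contradiction (trans (sym c) m) c₁≢c₄
      orbit-matches-unique (suc (suc (suc (suc n)))) d m c = trans
        (next⁴ (next^ n d))
        (orbit-matches-unique n d m (trans (cong (h ∘ tail) (sym (next⁴ (next^ n d)))) c))

      face-matches-unique : ∀ {d d′} → face d ≡ face d′ → MatchesAt d → MatchesAt d′ → d ≡ d′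
      face-matches-unique {d} {d′} same m (c , _) with Equivalence.to (face-orbit d d′) same
      ... | n , refl = sym (orbit-matches-unique n d m c)

      -- Double counting of pairs of a face and a matching dart on it: a face of this type has
      -- exactly one such dart, and every dart lies on exactly one face.
      #facesColored-darts : #facesColored Q h c₁ c₂ c₃ c₄ ≡ ∑ᵈ (along (match c₁ c₂ c₃ c₄))
      #facesColored-darts = begin
        #facesColored Q h c₁ c₂ c₃ c₄
          ≡⟨ length-filter-tabulate (clockwiseColors? Q h c₁ c₂ c₃ c₄) id ⟩
        sum (λ f → indicator (clockwiseColors? Q h c₁ c₂ c₃ c₄ f))
          ≡⟨ sum-cong-≗ (λ f → sum-indicator-unique
               (clockwiseColors? Q h c₁ c₂ c₃ c₄ f) (λ i → onFace? (to darts i) f)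
               (λ i q → to darts i , q)
               (λ (d , q) → from darts d , subst (OnFace f) (sym (strictlyInverseˡ darts d)) q)
               (λ (e , m) (e′ , m′) → dart-injective (face-matches-unique (trans e (sym e′)) m m′))) ⟨
        sum (λ f → ∑ᵈ λ d → indicator (onFace? d f))
          ≡⟨ ∑-comm (λ f i → indicator (onFace? (to darts i) f)) ⟩
        ∑ᵈ (λ d → sum λ f → indicator (onFace? d f))
          ≡⟨ sum-cong-≗ (λ i → sum-indicator-unique
               (matchesAt? (to darts i)) (onFace? (to darts i))
               (λ _ (_ , m) → m) (λ m → _ , refl , m)
               (λ (e , _) (e′ , _) → trans (sym e) e′)) ⟩
        ∑ᵈ (along (match c₁ c₂ c₃ c₄)) ∎
        where
        OnFace : Face → Dart → Set
        OnFace f d = face d ≡ f × MatchesAt d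

        onFace? : ∀ d f → Dec (OnFace f d)
        onFace? d f = (face d ≟ f) ×-dec matchesAt? d

        dart-injective : ∀ {i j} → to darts i ≡ to darts j → i ≡ j
        dart-injective {i} {j} eq = trans (sym (strictlyInverseʳ darts i))
          (trans (cong (from darts) eq) (strictlyInverseʳ darts j))

    -- Balancing the weights over all darts.

    ∑ᵈ-weight : ∀ f w → ∑ᵈ (λ d → f d + 2 * along w d) ≡ ∑ᵈ f + 2 * ∑ᵈ (along w)
    ∑ᵈ-weight f w = begin
      ∑ᵈ (λ d → f d + 2 * along w d)
        ≡⟨ ∑-distrib-+ (f ∘ to darts) (λ i → 2 * along w (to darts i)) ⟩
      ∑ᵈ f + ∑ᵈ (λ d → 2 * along w d)
        ≡⟨ cong (∑ᵈ f +_) (*-distribˡ-sum 2 (along w ∘ to darts)) ⟨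
      ∑ᵈ f + 2 * ∑ᵈ (along w) ∎

    -- Reversal permutes the darts and exchanges tail with head: the two darts of an edge run in
    -- opposite directions.
    ∑ᵈ-φ⁺-antisymmetric : ∑ᵈ (λ d → φ⁺ (color 0 d) (color 1 d)) ≡ ∑ᵈ (λ d → φ⁺ (color 1 d) (color 0 d))
    ∑ᵈ-φ⁺-antisymmetric = begin
      ∑ᵈ (λ d → φ⁺ (h (tail d)) (h (tail (next d))))
        ≡⟨ sum-cong-≗ (λ i → cong (λ v → φ⁺ (h (tail (to darts i))) (h v)) (tail-next (to darts i))) ⟩
      ∑ᵈ (λ d → φ⁺ (h (tail d)) (h (head d)))
        ≡⟨ sum-reindex darts reverse↔ (λ d → φ⁺ (h (tail d)) (h (head d))) ⟨
      ∑ᵈ (λ d → φ⁺ (h (head d)) (h (head (reverse d))))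
        ≡⟨ sum-cong-≗ (λ i → cong₂ (λ u v → φ⁺ (h u) (h v))
             (sym (tail-next (to darts i))) (head-reverse (to darts i))) ⟩
      ∑ᵈ (λ d → φ⁺ (h (tail (next d))) (h (tail d))) ∎

    module _ (proper : ProperColoring Q h) where

      consecutive-colors : ∀ n d → color n d ≢ color (suc n) d
      consecutive-colors n d eq =
        proper (next^ n d) (trans eq (cong h (tail-next (next^ n d))))

      -- The weights may differ at a single dart and agree only in total over the four darts of a
      -- boundary. Summing these totals over all darts gives four times each side.
      ∑ᵈ-weight⁺≡weight⁻ : ∑ᵈ (along weight⁺) ≡ ∑ᵈ (along weight⁻)
      ∑ᵈ-weight⁺≡weight⁻ = ℕ.*-cancelˡ-≡ _ _ 4 (begin
        4 * ∑ᵈ (along weight⁺)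
          ≡⟨ ∑ᵈ-boundary (along weight⁺) ⟨
        ∑ᵈ (λ d → sum {4} λ i → along weight⁺ (next^ (toℕ i) d))
          ≡⟨ sum-cong-≗ (λ i → pointwise (to darts i)) ⟩
        ∑ᵈ (λ d → sum {4} λ i → along weight⁻ (next^ (toℕ i) d))
          ≡⟨ ∑ᵈ-boundary (along weight⁻) ⟩
        4 * ∑ᵈ (along weight⁻) ∎)
        where
        pointwise : ∀ d → sum {4} (λ i → along weight⁺ (next^ (toℕ i) d))
                        ≡ sum {4} (λ i → along weight⁻ (next^ (toℕ i) d))
        pointwise d = begin
          sum {4} (λ i → along weight⁺ (next^ (toℕ i) d))
            ≡⟨ along-boundary weight⁺ d ⟩
          along (rotationSum weight⁺) d
            ≡⟨ rotationSum-weight (color 0 d) (color 1 d) (color 2 d) (color 3 d)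
                 (consecutive-colors 0 d) (consecutive-colors 1 d) (consecutive-colors 2 d)
                 -- Four steps return to `d`, so the last inequality closes the cycle from the
                 -- fourth color to the first.
                 (subst (λ e → color 3 d ≢ h (tail e)) (next⁴ d) (consecutive-colors 3 d)) ⟩
          along (rotationSum weight⁻) d
            ≡⟨ along-boundary weight⁻ d ⟨
          sum {4} (λ i → along weight⁻ (next^ (toℕ i) d)) ∎

      #facesColored-0123 : #facesColored Q h 0F 1F 2F 3F ≡ #facesColored Q h 3F 2F 1F 0F
      #facesColored-0123 = begin
        #facesColored Q h 0F 1F 2F 3F
          ≡⟨ #facesColored-darts (λ ()) (λ ()) (λ ()) ⟩
        ∑ᵈ (along (match 0F 1F 2F 3F))
          -- Both sides of `balance` carry the same `φ⁺` sum; cancelling it and then the factor 2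
          -- leaves the two counts.
          ≡⟨ ℕ.*-cancelˡ-≡ _ _ 2 (ℕ.+-cancelˡ-≡ (∑ᵈ (λ d → φ⁺ (color 1 d) (color 0 d))) _ _ balance) ⟩
        ∑ᵈ (along (match 3F 2F 1F 0F))
          ≡⟨ #facesColored-darts (λ ()) (λ ()) (λ ()) ⟨
        #facesColored Q h 3F 2F 1F 0F ∎
        where
        balance : ∑ᵈ (λ d → φ⁺ (color 1 d) (color 0 d)) + 2 * ∑ᵈ (along (match 0F 1F 2F 3F))
                ≡ ∑ᵈ (λ d → φ⁺ (color 1 d) (color 0 d)) + 2 * ∑ᵈ (along (match 3F 2F 1F 0F))
        balance = begin
          ∑ᵈ (λ d → φ⁺ (color 1 d) (color 0 d)) + 2 * ∑ᵈ (along (match 0F 1F 2F 3F))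
            ≡⟨ ∑ᵈ-weight (λ d → φ⁺ (color 1 d) (color 0 d)) (match 0F 1F 2F 3F) ⟨
          ∑ᵈ (along weight⁻)
            ≡⟨ ∑ᵈ-weight⁺≡weight⁻ ⟨
          ∑ᵈ (along weight⁺)
            ≡⟨ ∑ᵈ-weight (λ d → φ⁺ (color 0 d) (color 1 d)) (match 3F 2F 1F 0F) ⟩
          ∑ᵈ (λ d → φ⁺ (color 0 d) (color 1 d)) + 2 * ∑ᵈ (along (match 3F 2F 1F 0F))
            ≡⟨ cong (_+ 2 * ∑ᵈ (along (match 3F 2F 1F 0F))) ∑ᵈ-φ⁺-antisymmetric ⟩
          ∑ᵈ (λ d → φ⁺ (color 1 d) (color 0 d)) + 2 * ∑ᵈ (along (match 3F 2F 1F 0F)) ∎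

  -- Renaming arbitrary colors to 0, 1, 2, 3.

  #facesColored-recolor : ∀ {g h : Vertex → Color} {c₁ c₂ c₃ c₄ c₁′ c₂′ c₃′ c₄′} →
    (∀ v → g v ≡ c₁ ⇔ h v ≡ c₁′) → (∀ v → g v ≡ c₂ ⇔ h v ≡ c₂′) →
    (∀ v → g v ≡ c₃ ⇔ h v ≡ c₃′) → (∀ v → g v ≡ c₄ ⇔ h v ≡ c₄′) →
    #facesColored Q g c₁ c₂ c₃ c₄ ≡ #facesColored Q h c₁′ c₂′ c₃′ c₄′
  #facesColored-recolor {g} {h} e₁ e₂ e₃ e₄ = cong length (filter-≐
    (clockwiseColors? Q g _ _ _ _) (clockwiseColors? Q h _ _ _ _)
    ( (λ (d , f , m₁ , m₂ , m₃ , m₄) →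
         d , f , Equivalence.to (e₁ _) m₁ , Equivalence.to (e₂ _) m₂
               , Equivalence.to (e₃ _) m₃ , Equivalence.to (e₄ _) m₄)
    , (λ (d , f , m₁ , m₂ , m₃ , m₄) →
         d , f , Equivalence.from (e₁ _) m₁ , Equivalence.from (e₂ _) m₂
               , Equivalence.from (e₃ _) m₃ , Equivalence.from (e₄ _) m₄))
    (allFin #faces))

theorem1 : (k : ℕ) (Q : Quadrangulation k)
    (g : Quadrangulation.Vertex Q → Color) → ProperColoring Q g →
    (c₁ c₂ c₃ c₄ : Color) → (∀ c → c ∈ c₁ ∷ c₂ ∷ c₃ ∷ c₄ ∷ []) →
    #facesColored Q g c₁ c₂ c₃ c₄ ≡ #facesColored Q g c₄ c₃ c₂ c₁
theorem1 k Q g proper c₁ c₂ c₃ c₄ cover = begin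
  #facesColored Q g c₁ c₂ c₃ c₄
    ≡⟨ #facesColored-recolor Q (recolor 0F) (recolor 1F) (recolor 2F) (recolor 3F) ⟩
  #facesColored Q (position ∘ g) 0F 1F 2F 3F
    ≡⟨ #facesColored-0123 Q (position ∘ g) (λ d → proper d ∘ position-injective) ⟩
  #facesColored Q (position ∘ g) 3F 2F 1F 0F
    ≡⟨ #facesColored-recolor Q (recolor 3F) (recolor 2F) (recolor 1F) (recolor 0F) ⟨
  #facesColored Q g c₄ c₃ c₂ c₁ ∎
  where
  colors = c₁ ∷ c₂ ∷ c₃ ∷ c₄ ∷ []

  position : Color → Fin 4
  position c = index (cover c)

  lookup-position : ∀ c → c ≡ lookup colors (position c)
  lookup-position c = lookup-index (cover c)

  position-injective : Injective _≡_ _≡_ position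
  position-injective {c} {c′} eq =
    trans (lookup-position c) (trans (cong (lookup colors) eq) (sym (lookup-position c′)))

  -- Distinctness of the four colors enters by counting: `position` is injective on a four-element
  -- set, hence onto, so `i` is the position of some `c`, and `lookup colors i` is that `c`.
  position-lookup : ∀ i → position (lookup colors i) ≡ i
  position-lookup i with injective⇒strictlySurjective position-injective i
  ... | c , refl = cong position (sym (lookup-position c))

  recolor : ∀ i v → g v ≡ lookup colors i ⇔ position (g v) ≡ i
  recolor i v = mk⇔
    (λ eq → trans (cong position eq) (position-lookup i))
    (λ eq → trans (lookup-position (g v)) (cong (lookup colors) eq))
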